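{- Let $\Sigma$ be a finite alphabet and let $L(\mathcal{A})\subseteq T_\Sigma^\omega$ be a regular tree language accepted by an unambiguous Büchi tree automaton $\mathcal{A}$. Then $L(\mathcal{A})$ is a Borel subset of $T_\Sigma^\omega$.
   Context: For a finite alphabet $\Sigma$, $T_\Sigma^\omega$ is the set of all functions $t:\{l,r\}^\star\to\Sigma$ (infinite binary trees labelled in $\Sigma$, with root the empty word $\lambda$), with the Cantor (product of discrete) topology. A path of $t$ is an infinite sequence $t(u_0)t(u_1)\cdots$ of labels along an infinite branch, where $u_0=\lambda$ and $u_{i+1}\in\{u_il,u_ir\}$ for all $i$. A (nondeterministic) Büchi tree automaton is a tuple $\mathcal{A}=(K,\Sigma,\Delta,q_0,F)$ with $K$ a finite set of states, $\Sigma$ a finite alphabet, $\Delta\subseteq K\times\Sigma\times K\times K$, $q_0\in K$ and $F\subseteq K$. A run of $\mathcal{A}$ on $t\in T_\Sigma^\omega$ is a tree $\rho\in T_K^\omega$ with $\rho(\lambda)=q_0$ and $(\rho(u),t(u),\rho(u\cdot l),\rho(u\cdot r))\in\Delta$ for all $u\in\{l,r\}^\star$. The run is accepting if on each path of $\rho$ some state of $F$ appears infinitely often. $L(\mathcal{A})$ is the set of trees $t\in T_\Sigma^\omega$ on which $\mathcal{A}$ has at least one accepting run. (A tree language accepted by a Büchi tree automaton is in particular regular, i.e. accepted by some Muller tree automaton, so "regular" imposes no additional condition.) $\mathcal{A}$ is unambiguous if each tree $t\in T_\Sigma^\omega$ admits at most one accepting run of $\mathcal{A}$. -}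

module Defs where

open import Level using (0ℓ; suc)
open import Data.Nat using (ℕ; _≥_) renaming (suc to 1+_)
open import Data.Fin using (Fin)
open import Data.List using (List; []; _∷ʳ_)
open import Data.List.Relation.Unary.All using (All)
open import Data.Product using (∃; ∃-syntax; _×_; _,_)
open import Data.Sum using (_⊎_)
open import Function.Bundles using (_↔_)
open import Relation.Binary.PropositionalEquality using (_≡_; _≗_)
open import Relation.Unary using (Pred; _∈_; _≐_; ∁; ⋃)

IsFinite : Set → Set
IsFinite A = ∃[ n ] (A ↔ Fin n)

data Direction : Set where
  l r : Direction

-- Words are read from the root downwards, so the children of u are
-- u ∷ʳ l and u ∷ʳ r.
Node : Set
Node = List Direction

Tree : Set → Set
Tree A = Node → A

record Branch : Set where
  field
    node  : ℕ → Node
    start : node 0 ≡ []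
    step  : ∀ i → (node (1+ i) ≡ node i ∷ʳ l) ⊎ (node (1+ i) ≡ node i ∷ʳ r)

path : ∀ {A} → Tree A → Branch → ℕ → A
path t β i = t (Branch.node β i)

InfinitelyOften : ∀ {A : Set} → A → (ℕ → A) → Set
InfinitelyOften a s = ∀ n → ∃[ m ] (m ≥ n × s m ≡ a)

record BüchiTreeAutomaton (A : Set) : Set (suc 0ℓ) where
  field
    K        : Set
    K-finite : IsFinite K
    Δ        : Pred (K × A × K × K) 0ℓ
    q₀       : K
    F        : Pred K 0ℓ

module _ {A : Set} (𝒜 : BüchiTreeAutomaton A) where
  open BüchiTreeAutomaton 𝒜

  record IsRun (t : Tree A) (ρ : Tree K) : Set where
    field
      initial    : ρ [] ≡ q₀
      transition : ∀ u → (ρ u , t u , ρ (u ∷ʳ l) , ρ (u ∷ʳ r)) ∈ Δ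

  Accepting : Tree K → Set
  Accepting ρ = ∀ β → ∃[ q ] (q ∈ F × InfinitelyOften q (path ρ β))

  AcceptingRun : Tree A → Tree K → Set
  AcceptingRun t ρ = IsRun t ρ × Accepting ρ

  L : Pred (Tree A) 0ℓ
  L t = ∃[ ρ ] AcceptingRun t ρ

  -- Trees are functions, so equality of runs is pointwise equality.
  Unambiguous : Set
  Unambiguous = ∀ t ρ ρ′ → AcceptingRun t ρ → AcceptingRun t ρ′ → ρ ≗ ρ′

-- The product of the discrete topologies: a basic neighbourhood of t fixes
-- the labels of t at finitely many nodes.
Open : ∀ {A} → Pred (Tree A) 0ℓ → Set
Open U = ∀ t → t ∈ U →
  ∃[ us ] (∀ t′ → All (λ u → t′ u ≡ t u) us → t′ ∈ U)

-- The σ-algebra generated by the open sets.  Subsets are predicates, and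
-- `resp` identifies predicates with the same elements.
data Borel {A : Set} : Pred (Tree A) 0ℓ → Set (suc 0ℓ) where
  open-set   : ∀ {U} → Open U → Borel U
  complement : ∀ {U} → Borel U → Borel (∁ U)
  union      : ∀ (U : ℕ → Pred (Tree A) 0ℓ) → (∀ n → Borel (U n)) → Borel (⋃ ℕ U)
  resp       : ∀ {U V} → U ≐ V → Borel U → Borel V

-- By König's lemma a run ρ is accepting iff some d : Node → ℕ satisfies
-- d u = 0 when ρ u ∈ F and d u = 1 + max (d (ul)) (d (ur)) otherwise; this d
-- is then unique, so that the pairs (ρ , d) for accepting runs ρ on t form a
-- closed condition on (t , ρ , d), and unambiguity says that t determines
-- (ρ , d).  Hence L 𝒜 is the injective projection of a closed subset of
-- Tree (A × K × ℕ), which is Borel by the Lusin–Souslin theorem.  Since only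
-- small propositions can be decided, Lusin's separation theorem is proved by
-- well-founded recursion on finite approximations rather than by
-- contradiction.
module Submission where

open import Level using (0ℓ)
open import Axiom.ExcludedMiddle using (ExcludedMiddle)
open import Defs

open import Data.Empty using (⊥-elim)
open import Data.Fin using (toℕ)
open import Data.Fin.Properties using (toℕ-injective)
open import Data.List
  using (List; []; _∷_; _∷ʳ_; length; allFin; applyDownFrom)
open import Data.List.Membership.Propositional.Properties using (∈-allFin)
open import Data.List.Properties using (length-applyDownFrom)
open import Data.List.Relation.Unary.All as All using (All; []; _∷_)
open import Data.List.Reverse using (Reverse; reverseView; []; _∶_∶ʳ_)
open import Data.Nat using (ℕ; zero; suc; _+_; _∸_; _⊔_; _≤_; _<_; _≥_)
open import Data.Nat.Binary as ℕᵇ using (ℕᵇ; 2[1+_]; 1+[2_])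
open import Data.Nat.Binary.Properties as ℕᵇ using ()
open import Data.Nat.Properties
open import Data.Product using (∃-syntax; _×_; _,_; proj₁; proj₂)
open import Data.Sum using (_⊎_; inj₁; inj₂)
open import Data.Unit using (⊤; tt)
open import Function using (_∘_; id)
open import Function.Bundles using (_↣_; mk↣; module Injection; module Inverse)
open import Function.Construct.Composition using (_↣-∘_)
open import Function.Construct.Identity using (↣-id)
open import Function.Properties.Inverse using (↔⇒↣)
open import Induction.WellFounded as WF
  using (Acc; acc; WellFounded; module FixPoint)
open import Relation.Binary using (Rel)
open import Relation.Binary.PropositionalEquality
  using (_≡_; _≢_; _≗_; refl; sym; trans; cong; cong₂; subst)
open import Relation.Nullary using (¬_; yes; no; contradiction)
open import Relation.Nullary.Decidable using (decidable-stable)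
open import Relation.Unary
  using (Pred; _∈_; _⊆_; _≐_; ∁; ⋃; ⋂; _∩_; ∅; U; Satisfiable)

open Injection using () renaming (to to code; injective to code-injective)

-- Countability of products, lists and nodes.

pairᵇ : ℕ → ℕᵇ → ℕᵇ
pairᵇ zero    b = 2[1+ b ]
pairᵇ (suc i) b = 1+[2 pairᵇ i b ]

-- The numerals `ℕᵇ` are words in two digits. The code spells `i` in unary with one digit, ends it
-- with the other, and continues with `b`, so it can be parsed back.
pairᵇ-injective : ∀ i j {b c} → pairᵇ i b ≡ pairᵇ j c → i ≡ j × b ≡ c
pairᵇ-injective zero    zero    eq = refl , ℕᵇ.2[1+_]-injective eq
pairᵇ-injective (suc i) (suc j) eq
  with i≡j , b≡c ← pairᵇ-injective i j (ℕᵇ.1+[2_]-injective eq) = cong suc i≡j , b≡c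

pair : ℕ → ℕ → ℕ
pair m n = ℕᵇ.toℕ (pairᵇ m (ℕᵇ.fromℕ n))

pair-injective : ∀ m m′ {n n′} → pair m n ≡ pair m′ n′ → m ≡ m′ × n ≡ n′
pair-injective m m′ eq
  with m≡m′ , eq′ ← pairᵇ-injective m m′ (ℕᵇ.toℕ-injective eq) =
  m≡m′ , ℕᵇ.fromℕ-injective eq′

×-countable : {I J : Set} → I ↣ ℕ → J ↣ ℕ → (I × J) ↣ ℕ
×-countable f g = mk↣ {to = λ (i , j) → pair (code f i) (code g j)} λ {(i , j)} {(i′ , j′)} eq →
  let eq₁ , eq₂ = pair-injective (code f i) (code f i′) eq
  in cong₂ _,_ (code-injective f eq₁) (code-injective g eq₂)

listCode : {I : Set} → I ↣ ℕ → List I → ℕ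
listCode f []       = 0
listCode f (x ∷ xs) = suc (pair (code f x) (listCode f xs))

listCode-injective : {I : Set} (f : I ↣ ℕ) (xs ys : List I) →
  listCode f xs ≡ listCode f ys → xs ≡ ys
listCode-injective f []       []       eq = refl
listCode-injective f (x ∷ xs) (y ∷ ys) eq =
  let eq₁ , eq₂ = pair-injective (code f x) (code f y) (suc-injective eq)
  in cong₂ _∷_ (code-injective f eq₁) (listCode-injective f xs ys eq₂)

List-countable : {I : Set} → I ↣ ℕ → List I ↣ ℕ
List-countable f = mk↣ (λ {xs} {ys} → listCode-injective f xs ys)

IsFinite⇒countable : {I : Set} → IsFinite I → I ↣ ℕ
IsFinite⇒countable (n , I↔Fin) = mk↣ {to = toℕ} toℕ-injective ↣-∘ ↔⇒↣ I↔Fin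

Direction-countable : Direction ↣ ℕ
Direction-countable = mk↣ {to = to} injective
  where
  to : Direction → ℕ
  to l = 0
  to r = 1

  injective : ∀ {x y} → to x ≡ to y → x ≡ y
  injective {l} {l} eq = refl
  injective {r} {r} eq = refl

Node-countable : Node ↣ ℕ
Node-countable = List-countable Direction-countable

bounded : {I : Set} (h : I → ℕ) (is : List I) → ∃[ n ] All (λ i → h i < n) is
bounded h []       = 0 , []
bounded h (i ∷ is) with n , h<n ← bounded h is =
  suc (h i) ⊔ n , m≤m⊔n _ n ∷ All.map (λ p → ≤-trans p (m≤n⊔m _ n)) h<n

-- Consequences of excluded middle.

module Classical (em : ExcludedMiddle 0ℓ) where

  by-contradiction : {P : Set} → ¬ ¬ P → P
  by-contradiction = decidable-stable em

  ¬∀⇒∃¬ : {I : Set} {P : Pred I 0ℓ} → ¬ (∀ i → P i) → ∃[ i ] ¬ P i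
  ¬∀⇒∃¬ ¬∀ = by-contradiction λ ¬∃ → ¬∀ λ i → by-contradiction λ ¬p → ¬∃ (i , ¬p)

  -- Excluded middle yields actual witnesses of ∃, so no choice is needed.
  noDescent⇒Acc : {S : Set} (_≺_ : Rel S 0ℓ) (s : S) →
    (∀ (f : ℕ → S) → f 0 ≡ s → ¬ (∀ n → f (suc n) ≺ f n)) → Acc _≺_ s
  noDescent⇒Acc {S} _≺_ s noDescent = by-contradiction λ ¬a →
    noDescent (proj₁ ∘ descent ¬a) refl λ n → proj₁ (proj₂ (descend (descent ¬a n)))
    where
    Inacc : Set
    Inacc = ∃[ s ] ¬ Acc _≺_ s

    descend : ((s , _) : Inacc) → ∃[ s′ ] (s′ ≺ s × ¬ Acc _≺_ s′)
    descend (s , ¬a) = by-contradiction λ ¬∃ →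
      ¬a (acc λ {s′} s′≺s → by-contradiction λ ¬a′ → ¬∃ (s′ , s′≺s , ¬a′))

    descent : ¬ Acc _≺_ s → ℕ → Inacc
    descent ¬a zero    = s , ¬a
    descent ¬a (suc n) =
      let s′ , _ , ¬a′ = descend (descent ¬a n) in s′ , ¬a′

  -- Pigeonhole: if no state of `F` recurred, each would have a last visit, and finiteness would
  -- give a common `N` after which `F` is never visited.
  infinitelyOften-∈ : {K : Set} → IsFinite K → (F : Pred K 0ℓ) (s : ℕ → K) →
    (∀ n → ∃[ m ] (m ≥ n × s m ∈ F)) → ∃[ q ] (q ∈ F × InfinitelyOften q s)
  infinitelyOften-∈ {K} (k , K↔Fin) F s io = by-contradiction λ ¬∃ →
    let late : (q : K) → ∃[ n ] (q ∈ F → ∀ m → m ≥ n → s m ≢ q)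
        -- The bound 0 is a dummy: if no bound works for `q` in `F`, then `q` recurs, against `¬∃`.
        late q = by-contradiction λ ¬late → ¬late (0 , λ q∈F → ⊥-elim (¬∃ (q , q∈F ,
          λ n → by-contradiction λ ¬m → ¬late (n , λ _ m m≥n eq → ¬m (m , m≥n , eq)))))
        N , late<N = bounded (proj₁ ∘ late ∘ from) (allFin k)
        m , m≥N , sm∈F = io N
        lm<N = subst (λ q → proj₁ (late q) < N) (strictlyInverseʳ (s m))
                 (All.lookup late<N (∈-allFin (to (s m))))
    in proj₂ (late (s m)) sm∈F m (≤-trans (<⇒≤ lm<N) m≥N) refl
    where open Inverse K↔Fin

  -- An enumeration of the nodes. Numbers that code no node go to the root, which merely constrains
  -- the root label again.
  ν : ℕ → Node
  ν n with em {∃[ u ] code Node-countable u ≡ n}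
  ... | yes (u , _) = u
  ... | no _        = []

  ν-code : ∀ u → ν (code Node-countable u) ≡ u
  ν-code u with em {∃[ v ] code Node-countable v ≡ code Node-countable u}
  ... | yes (v , eq) = code-injective Node-countable eq
  ... | no ¬∃        = contradiction (u , refl) ¬∃

  -- Countable Borel operations and Borel separation.

  module _ {A : Set} where

    Borel-∅ : Borel {A} ∅
    Borel-∅ = open-set λ _ ()

    Borel-U : Borel {A} U
    Borel-U = open-set λ _ _ → [] , λ _ _ → tt

    -- Injectivity of the code makes each `W n` either a single `V i` or empty, and excluded middle
    -- decides which.
    Borel-⋃ : {I : Set} → I ↣ ℕ → {V : I → Pred (Tree A) 0ℓ} →
      (∀ i → Borel (V i)) → Borel (⋃ I V)
    Borel-⋃ {I} f {V} bV = resp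
      ((λ (_ , i , _ , t∈V) → i , t∈V) , (λ (i , t∈V) → code f i , i , refl , t∈V))
      (union W bW)
      where
      W : ℕ → Pred (Tree A) 0ℓ
      W n t = ∃[ i ] (code f i ≡ n × t ∈ V i)

      bW : ∀ n → Borel (W n)
      bW n with em {∃[ i ] code f i ≡ n}
      ... | yes (i , eq) = resp
        ( (λ t∈V → i , eq , t∈V)
        , (λ {t} (j , eq′ , t∈V) →
             subst (λ k → t ∈ V k) (code-injective f (trans eq′ (sym eq))) t∈V))
        (bV i)
      ... | no ¬∃ = resp ((λ ()) , (λ (i , eq , _) → ⊥-elim (¬∃ (i , eq)))) Borel-∅

    Borel-⋂ : {I : Set} → I ↣ ℕ → {V : I → Pred (Tree A) 0ℓ} →
      (∀ i → Borel (V i)) → Borel (⋂ I V)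
    Borel-⋂ f bV = resp
      ( (λ t∉ i → by-contradiction λ t∉V → t∉ (i , t∉V))
      , (λ t∈ (i , t∉V) → t∉V (t∈ i)))
      (complement (Borel-⋃ f (complement ∘ bV)))

    Borel-∩ : {V W : Pred (Tree A) 0ℓ} → Borel V → Borel W → Borel (V ∩ W)
    Borel-∩ {V} {W} bV bW = resp
      ((λ t∈ → t∈ 0 , t∈ 1) , (λ { (t∈V , t∈W) zero → t∈V ; (t∈V , t∈W) (suc _) → t∈W }))
      (Borel-⋂ (↣-id ℕ) {VW} λ { zero → bV ; (suc _) → bW })
      where
      VW : ℕ → Pred (Tree A) 0ℓ
      VW zero    = V
      VW (suc _) = W

    Borel-if : (C : Set) {V : Pred (Tree A) 0ℓ} → Borel V → Borel (λ t → C → t ∈ V)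
    Borel-if C bV with em {C}
    ... | yes c = resp ((λ t∈V _ → t∈V) , (λ t∈ → t∈ c)) bV
    ... | no ¬c = resp ((λ _ → ⊥-elim ∘ ¬c) , (λ _ → tt)) Borel-U

    Borel-label : ∀ u (a : A) → Borel (λ t → a ≡ t u)
    Borel-label u a = open-set λ { t eq → u ∷ [] , λ { t′ (eq′ ∷ []) → trans eq (sym eq′) } }

    Separable : (V W : Pred (Tree A) 0ℓ) → Set₁
    Separable V W = ∃[ S ] (Borel S × V ⊆ S × W ⊆ ∁ S)

    Separable-⊆ : {V V′ W W′ : Pred (Tree A) 0ℓ} → V′ ⊆ V → W′ ⊆ W →
      Separable V W → Separable V′ W′
    Separable-⊆ V′⊆V W′⊆W (S , bS , V⊆S , W⊆∁S) = S , bS , V⊆S ∘ V′⊆V , W⊆∁S ∘ W′⊆W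

    -- The separator is the union over `i` of the intersections over `j` of the given ones: a point
    -- of `W j` already fails the `j`-th condition for every `i`.
    Separable-⋃ : {I : Set} → I ↣ ℕ → {V W : I → Pred (Tree A) 0ℓ} →
      (∀ i j → Separable (V i) (W j)) → Separable (⋃ I V) (⋃ I W)
    Separable-⋃ {I} f sep =
      (λ t → ∃[ i ] ∀ j → t ∈ proj₁ (sep i j)) ,
      Borel-⋃ f (λ i → Borel-⋂ f λ j → proj₁ (proj₂ (sep i j))) ,
      (λ (i , t∈V) → i , λ j → proj₁ (proj₂ (proj₂ (sep i j))) t∈V) ,
      (λ (j , t∈W) (i , t∈S) → proj₂ (proj₂ (proj₂ (sep i j))) t∈W (t∈S j))

  -- Closed sets and limits of finite approximations.

  Closed : {Z : Set} → Pred (Tree Z) 0ℓ → Set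
  Closed P = Open (∁ P)

  -- A list wₙ₋₁ ∷ … ∷ w₀ ∷ [] prescribes the label h wᵢ at the node ν i.
  Extends : {Z W : Set} → (W → Z) → Tree Z → List W → Set
  Extends h x []       = ⊤
  Extends h x (w ∷ ws) = h w ≡ x (ν (length ws)) × Extends h x ws

  module _ {Z W : Set} {h : W → Z} (g : ℕ → W) where

    Extends-lookup : ∀ {x} n {i} → i < n →
      Extends h x (applyDownFrom g n) → h (g i) ≡ x (ν i)
    Extends-lookup {x} (suc n) i<1+n (eq , ext) with m<1+n⇒m<n∨m≡n i<1+n
    ... | inj₁ i<n  = Extends-lookup n i<n ext
    ... | inj₂ refl = trans eq (cong (x ∘ ν) (length-applyDownFrom g n))

    -- Otherwise a neighbourhood of `y` avoids `P`. It depends on finitely many nodes, all with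
    -- codes below some `n`, and the `n`-th approximation is a point of `P` agreeing with `y` there.
    Closed-limit : {P : Pred (Tree Z) 0ℓ} → Closed P →
      (∀ n → ∃[ x ] (x ∈ P × Extends h x (applyDownFrom g n))) →
      ∀ {y} → (∀ u → h (g (code Node-countable u)) ≡ y u) → y ∈ P
    Closed-limit {P} closed approx {y} limit = by-contradiction λ y∉P →
      let us , nbhd = closed y y∉P
          n , us<n = bounded (code Node-countable) us
          x , x∈P , ext = approx n
      in nbhd x (All.map (λ {u} u<n → agree n x ext u u<n) us<n) x∈P
      where
      agree : ∀ n x → Extends h x (applyDownFrom g n) →
        ∀ u → code Node-countable u < n → x u ≡ y u
      agree n x ext u u<n =
        trans (cong x (sym (ν-code u)))
          (trans (sym (Extends-lookup n u<n ext)) (limit u))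

  -- Lusin's separation theorem for images of closed sets.

  module _ {Z A : Set} (π : Z → A) where

    Image : Pred (Tree Z) 0ℓ → Pred (Tree A) 0ℓ
    Image P t = ∃[ x ] (x ∈ P × π ∘ x ≗ t)

    module Lusin (Z-countable : Z ↣ ℕ) {P Q : Pred (Tree Z) 0ℓ}
      (P-closed : Closed P) (Q-closed : Closed Q)
      (disjoint : ∀ {x y} → x ∈ P → y ∈ Q → ¬ (π ∘ x ≗ π ∘ y)) where

      -- One list of pairs approximates a point of `P` by its first components and a point of `Q` by
      -- its second ones.
      W : Set
      W = Z × Z

      P⟨_⟩ Q⟨_⟩ : List W → Pred (Tree Z) 0ℓ
      P⟨ s ⟩ x = x ∈ P × Extends proj₁ x s
      Q⟨ s ⟩ y = y ∈ Q × Extends proj₂ y s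

      -- One step in the search for points of `P` and `Q` with the same projection. The premises are
      -- the conditions under which `separate` has to recurse; satisfiability supplies the
      -- approximations that `Closed-limit` needs.
      data _≺_ : Rel (List W) 0ℓ where
        extend : ∀ {s z z′} → π z ≡ π z′ → Satisfiable P⟨ s ⟩ → Satisfiable Q⟨ s ⟩ →
                 ((z , z′) ∷ s) ≺ s

      ≺-cons : ∀ {s s′} → s′ ≺ s → ∃[ w ] (s′ ≡ w ∷ s × π (proj₁ w) ≡ π (proj₂ w))
      ≺-cons (extend eq _ _) = _ , refl , eq

      ≺-satisfiable : ∀ {s s′} → s′ ≺ s → Satisfiable P⟨ s ⟩ × Satisfiable Q⟨ s ⟩
      ≺-satisfiable (extend _ p q) = p , q

      module _ {f : ℕ → List W} (f0 : f 0 ≡ []) (desc : ∀ n → f (suc n) ≺ f n) where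

        g : ℕ → W
        g n = proj₁ (≺-cons (desc n))

        f-prefix : ∀ n → f n ≡ applyDownFrom g n
        f-prefix zero    = f0
        f-prefix (suc n) =
          trans (proj₁ (proj₂ (≺-cons (desc n)))) (cong (g n ∷_) (f-prefix n))

        limit-∈P : (proj₁ ∘ g ∘ code Node-countable) ∈ P
        limit-∈P = Closed-limit {h = proj₁} g P-closed
          (λ n → subst (λ s → Satisfiable P⟨ s ⟩) (f-prefix n) (proj₁ (≺-satisfiable (desc n))))
          (λ _ → refl)

        limit-∈Q : (proj₂ ∘ g ∘ code Node-countable) ∈ Q
        limit-∈Q = Closed-limit {h = proj₂} g Q-closed
          (λ n → subst (λ s → Satisfiable Q⟨ s ⟩) (f-prefix n) (proj₂ (≺-satisfiable (desc n))))
          (λ _ → refl)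

      -- An infinite search would converge to a point of `P` and a point of `Q` whose projections
      -- agree at every node, against disjointness.
      []-acc : Acc _≺_ []
      []-acc = noDescent⇒Acc _≺_ [] λ f f0 desc →
        disjoint (limit-∈P f0 desc) (limit-∈Q f0 desc)
          λ u → proj₂ (proj₂ (≺-cons (desc (code Node-countable u))))

      -- Both images are split by the label at the next node, and `Separable-⋃` glues separators of
      -- the pieces. If either side is empty, a trivial set separates.
      separate : ∀ s → Acc _≺_ s → Separable (Image P⟨ s ⟩) (Image Q⟨ s ⟩)
      separate s (acc rs) with em {Satisfiable P⟨ s ⟩} | em {Satisfiable Q⟨ s ⟩}
      ... | no ¬p | _     = ∅ , Borel-∅ , (λ (x , p , _) → ¬p (x , p)) , (λ _ ())
      ... | yes _ | no ¬q = U , Borel-U , (λ _ → tt) , (λ (y , q , _) _ → ¬q (y , q))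
      ... | yes p | yes q = Separable-⊆
        (λ (x , (x∈P , ext) , eq) → x u , x , (x∈P , refl , ext) , eq)
        (λ (y , (y∈Q , ext) , eq) → y u , y , (y∈Q , refl , ext) , eq)
        (Separable-⋃ Z-countable
          -- Each side reads one component only; the other copy of `z` is a filler, so that both
          -- families are indexed by `Z`.
          {λ z → Image P⟨ (z , z) ∷ s ⟩} {λ z → Image Q⟨ (z , z) ∷ s ⟩} split)
        where
        u = ν (length s)

        split : ∀ z z′ → Separable (Image P⟨ (z , z) ∷ s ⟩) (Image Q⟨ (z′ , z′) ∷ s ⟩)
        split z z′ with em {π z ≡ π z′}
        ... | yes eq = separate ((z , z′) ∷ s) (rs (extend eq p q))
        -- Distinct projected labels at `u` are told apart by a basic open set.
        ... | no neq =
          (λ t → π z ≡ t u) , Borel-label u (π z) ,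
          (λ (x , (_ , eq , _) , πx≗t) → trans (cong π eq) (πx≗t u)) ,
          (λ (y , (_ , eq , _) , πy≗t) πz≡tu →
             neq (trans πz≡tu (sym (trans (cong π eq) (πy≗t u)))))

      separation : Separable (Image P) (Image Q)
      separation = Separable-⊆
        (λ (x , x∈P , eq) → x , (x∈P , tt) , eq)
        (λ (y , y∈Q , eq) → y , (y∈Q , tt) , eq)
        (separate [] []-acc)

    -- The Lusin-Souslin theorem: injective images of closed sets.

    module LusinSouslin (Z-countable : Z ↣ ℕ) {P : Pred (Tree Z) 0ℓ} (P-closed : Closed P)
      (injective : ∀ {x y} → x ∈ P → y ∈ P → π ∘ x ≗ π ∘ y → x ≗ y) where

      P[_↦_] : Node → Z → Pred (Tree Z) 0ℓ
      P[ u ↦ z ] x = x ∈ P × z ≡ x u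

      P[↦]-closed : ∀ u z → Closed P[ u ↦ z ]
      P[↦]-closed u z x x∉ with em {x ∈ P}
      ... | yes x∈P = u ∷ [] , λ { y (yu≡xu ∷ []) (_ , eq) → x∉ (x∈P , trans eq yu≡xu) }
      ... | no x∉P with us , nbhd ← P-closed x x∉P = us , λ y agree → nbhd y agree ∘ proj₁

      -- Injectivity makes the images for distinct labels disjoint, so Lusin separation applies. On
      -- the diagonal `U` is a dummy, which keeps the family total for countable intersections.
      separator : ∀ u z z′ → ∃[ S ] (Borel S ×
        (z ≢ z′ → Image P[ u ↦ z ] ⊆ S) × (z ≢ z′ → Image P[ u ↦ z′ ] ⊆ ∁ S))
      separator u z z′ with em {z ≡ z′}
      ... | yes eq = U , Borel-U , contradiction eq , contradiction eq
      ... | no neq =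
        let S , bS , ⊆S , ⊆∁S = Lusin.separation Z-countable
              (P[↦]-closed u z) (P[↦]-closed u z′)
              λ (x∈P , eq) (y∈P , eq′) πx≗πy →
                neq (trans eq (trans (injective x∈P y∈P πx≗πy u) (sym eq′)))
        in S , bS , (λ _ → ⊆S) , (λ _ → ⊆∁S)

      S : Node → Z → Z → Pred (Tree A) 0ℓ
      S u z z′ = proj₁ (separator u z z′)

      -- A Borel set around the image of `P[ u ↦ z ]`. The separators for both orders of `z` and
      -- `z′` occur, so that for fixed `u` these sets are disjoint: `S u z z′` contains one and
      -- misses the other.
      C : Node → Z → Pred (Tree A) 0ℓ
      C u z t = π z ≡ t u × (∀ z′ → z ≢ z′ → t ∈ (S u z z′ ∩ ∁ (S u z′ z)))

      C-Borel : ∀ u z → Borel (C u z)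
      C-Borel u z = Borel-∩ (Borel-label u (π z))
        (Borel-⋂ Z-countable λ z′ → Borel-if (z ≢ z′)
          (Borel-∩ (proj₁ (proj₂ (separator u z z′)))
            (complement (proj₁ (proj₂ (separator u z′ z))))))

      C-disjoint : ∀ {u z z′ t} → t ∈ C u z → t ∈ C u z′ → z ≡ z′
      C-disjoint (_ , sep) (_ , sep′) = by-contradiction λ z≢z′ →
        proj₂ (sep′ _ (z≢z′ ∘ sym)) (proj₁ (sep _ z≢z′))

      image⊆C : ∀ {x t} → x ∈ P → π ∘ x ≗ t → ∀ u → t ∈ C u (x u)
      image⊆C {x} x∈P πx≗t u = πx≗t u , λ z′ neq →
        proj₁ (proj₂ (proj₂ (separator u (x u) z′))) neq (x , (x∈P , refl) , πx≗t) ,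
        proj₂ (proj₂ (proj₂ (separator u z′ (x u)))) (neq ∘ sym) (x , (x∈P , refl) , πx≗t)

      C* : List Z → Pred (Tree A) 0ℓ
      C* []       = U
      C* (z ∷ zs) = C (ν (length zs)) z ∩ C* zs

      C*-Borel : ∀ zs → Borel (C* zs)
      C*-Borel []       = Borel-U
      C*-Borel (z ∷ zs) = Borel-∩ (C-Borel _ z) (C*-Borel zs)

      C*⇒Extends : ∀ {x t} → (∀ u → t ∈ C u (x u)) → ∀ zs → t ∈ C* zs → Extends id x zs
      C*⇒Extends t∈C []       _           = tt
      C*⇒Extends t∈C (z ∷ zs) (t∈ , t∈zs) = C-disjoint t∈ (t∈C _) , C*⇒Extends t∈C zs t∈zs

      C*-prefix : ∀ {x t} → (∀ u → t ∈ C u (x u)) → ∀ n → t ∈ C* (applyDownFrom (x ∘ ν) n)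
      C*-prefix t∈C zero    = tt
      C*-prefix {x} {t} t∈C (suc n) =
        subst (λ k → t ∈ C (ν k) (x (ν n))) (sym (length-applyDownFrom (x ∘ ν) n)) (t∈C (ν n)) ,
        C*-prefix t∈C n

      -- Membership of `t` is tested by countably many conditions: every node has a label `z` with
      -- `t` in `C u z`, and no list of labels compatible with `t` lacks an extension in `P`.
      image-Borel : Borel (Image P)
      image-Borel = resp (⊆Image , Image⊆) (Borel-∩
        (Borel-⋂ Node-countable λ u → Borel-⋃ Z-countable (C-Borel u))
        (Borel-⋂ (List-countable Z-countable) λ zs →
          -- The premise does not mention `t`, so for each list it either holds throughout or
          -- imposes nothing.
          Borel-if (¬ (∃[ x ] (x ∈ P × Extends id x zs))) (complement (C*-Borel zs))))
        where
        D : Pred (Tree A) 0ℓ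
        D t = (∀ u → ∃[ z ] t ∈ C u z) ×
              (∀ zs → ¬ (∃[ x ] (x ∈ P × Extends id x zs)) → ¬ (t ∈ C* zs))

        Image⊆ : Image P ⊆ D
        Image⊆ (x , x∈P , πx≗t) =
          (λ u → x u , image⊆C x∈P πx≗t u) ,
          (λ zs ¬ext t∈ → ¬ext (x , x∈P , C*⇒Extends (image⊆C x∈P πx≗t) zs t∈))

        ⊆Image : D ⊆ Image P
        ⊆Image {t} (t∈C , approx) =
          x ,
          -- All finite prefixes of the selected labels extend to points of `P`, so their limit, the
          -- tree `x` itself, lies in `P`.
          Closed-limit (x ∘ ν) P-closed
            (λ n → by-contradiction λ ¬ext → approx _ ¬ext (C*-prefix (proj₂ ∘ t∈C) n))
            (λ u → cong x (ν-code u)) ,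
          (λ u → proj₁ (proj₂ (t∈C u)))
          where
          x : Tree Z
          x = proj₁ ∘ t∈C

  -- Accepting runs and their ranks.

  module Büchi {A : Set} (A-finite : IsFinite A) (𝒜 : BüchiTreeAutomaton A) where
    open BüchiTreeAutomaton 𝒜

    data Child (u : Node) : Node → Set where
      child : ∀ d → Child u (u ∷ʳ d)

    -- Acceptance speaks of branches from the root only; a chain starting at `u` is completed by the
    -- ancestors of `u`, added one at a time.
    prepend : ∀ {u} → Reverse u → (f : ℕ → Node) → f 0 ≡ u → (∀ i → Child (f i) (f (suc i))) →
      ∃[ β ] ∃[ k ] ∀ i → Branch.node β (k + i) ≡ f i
    prepend [] f f0 f-child = record { node = f ; start = f0 ; step = step } , 0 , λ _ → refl
      where
      step : ∀ i → f (suc i) ≡ f i ∷ʳ l ⊎ f (suc i) ≡ f i ∷ʳ r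
      step i with f (suc i) | f-child i
      ... | _ | child l = inj₁ refl
      ... | _ | child r = inj₂ refl
    prepend (u ∶ rev ∶ʳ d) f f0 f-child =
      let β , k , eq = prepend rev f′ refl f′-child
      in β , suc k , λ i → trans (cong (Branch.node β) (sym (+-suc k i))) (eq (suc i))
      where
      f′ : ℕ → Node
      f′ zero    = u
      f′ (suc i) = f i

      f′-child : ∀ i → Child (f′ i) (f′ (suc i))
      f′-child zero    = subst (Child u) (sym f0) (child d)
      f′-child (suc i) = f-child i

    data Descends (ρ : Tree K) (v u : Node) : Set where
      descends : ¬ (ρ u ∈ F) → Child u v → Descends ρ v u

    -- An infinite descent would be the tail of a branch and would avoid `F`, yet acceptance forces
    -- a visit to `F` after position `k`. Ranks can therefore be defined by recursion.
    Descends-wellFounded : ∀ {ρ} → Accepting 𝒜 ρ → WellFounded (Descends ρ)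
    Descends-wellFounded {ρ} accepting u = noDescent⇒Acc (Descends ρ) u noDescent
      where
      descends-child : ∀ {u v} → Descends ρ v u → Child u v
      descends-child (descends _ c) = c

      descends-∉F : ∀ {u v} → Descends ρ v u → ¬ (ρ u ∈ F)
      descends-∉F (descends ρu∉F _) = ρu∉F

      noDescent : ∀ f → f 0 ≡ u → ¬ (∀ n → Descends ρ (f (suc n)) (f n))
      noDescent f f0 desc
        with β , k , β≡f ← prepend (reverseView u) f f0 (descends-child ∘ desc)
        with q , q∈F , often ← accepting β
        with m , m≥k , eq ← often k =
        descends-∉F (desc (m ∸ k)) (subst (_∈ F) (trans (sym eq) (cong ρ βm≡f)) q∈F)
        where
        βm≡f : Branch.node β m ≡ f (m ∸ k)
        βm≡f = trans (cong (Branch.node β) (sym (m+[n∸m]≡n m≥k))) (β≡f (m ∸ k))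

    RankStep : K → ℕ → ℕ → ℕ → Set
    RankStep q n nˡ nʳ = (q ∈ F × n ≡ 0) ⊎ (¬ (q ∈ F) × n ≡ suc (nˡ ⊔ nʳ))

    Ranks : Tree K → Tree ℕ → Set
    Ranks ρ d = ∀ u → RankStep (ρ u) (d u) (d (u ∷ʳ l)) (d (u ∷ʳ r))

    module _ {ρ : Tree K} (accepting : Accepting 𝒜 ρ) where

      rankStep : ∀ u → (∀ {v} → Descends ρ v u → ℕ) → ℕ
      rankStep u rec with em {ρ u ∈ F}
      ... | yes _   = 0
      ... | no ρu∉F = suc (rec (descends ρu∉F (child l)) ⊔ rec (descends ρu∉F (child r)))

      rankStep-ext : ∀ u {rec rec′ : ∀ {v} → Descends ρ v u → ℕ} →
        (∀ {v} (v≺u : Descends ρ v u) → rec v≺u ≡ rec′ v≺u) → rankStep u rec ≡ rankStep u rec′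
      rankStep-ext u ext with em {ρ u ∈ F}
      ... | yes _   = refl
      ... | no ρu∉F = cong suc (cong₂ _⊔_ (ext _) (ext _))

      open FixPoint (Descends-wellFounded accepting) (λ _ → ℕ) rankStep rankStep-ext
        using (unfold-wfRec)

      rank : Tree ℕ
      rank = WF.All.wfRec (Descends-wellFounded accepting) 0ℓ (λ _ → ℕ) rankStep

      rankStep-RankStep : ∀ u (d : Tree ℕ) →
        RankStep (ρ u) (rankStep u (λ {v} _ → d v)) (d (u ∷ʳ l)) (d (u ∷ʳ r))
      rankStep-RankStep u d with em {ρ u ∈ F}
      ... | yes ρu∈F = inj₁ (ρu∈F , refl)
      ... | no ρu∉F  = inj₂ (ρu∉F , refl)

      rank-ranks : Ranks ρ rank
      rank-ranks u = subst (λ n → RankStep (ρ u) n (rank (u ∷ʳ l)) (rank (u ∷ʳ r)))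
        (sym (unfold-wfRec {u})) (rankStep-RankStep u rank)

    -- Induction on a strict bound for `d u`: at states in `F` both ranks are 0, elsewhere both
    -- children have smaller rank.
    Ranks-unique : ∀ {ρ ρ′ d d′} → ρ ≗ ρ′ → Ranks ρ d → Ranks ρ′ d′ → d ≗ d′
    Ranks-unique {ρ} {ρ′} {d} {d′} ρ≗ρ′ ranks ranks′ u = go (suc (d u)) u ≤-refl
      where
      go : ∀ n u → d u < n → d u ≡ d′ u
      go (suc n) u du<1+n with ranks u | ranks′ u
      ... | inj₁ (_ , eq)  | inj₁ (_ , eq′) = trans eq (sym eq′)
      ... | inj₁ (ρu∈F , _) | inj₂ (ρ′u∉F , _) = ⊥-elim (ρ′u∉F (subst (_∈ F) (ρ≗ρ′ u) ρu∈F))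
      ... | inj₂ (ρu∉F , _) | inj₁ (ρ′u∈F , _) = ⊥-elim (ρu∉F (subst (_∈ F) (sym (ρ≗ρ′ u)) ρ′u∈F))
      ... | inj₂ (_ , eq)  | inj₂ (_ , eq′) = trans eq (trans (cong suc (cong₂ _⊔_
        (go n (u ∷ʳ l) (≤-<-trans (m≤m⊔n _ _) max<n))
        (go n (u ∷ʳ r) (≤-<-trans (m≤n⊔m _ _) max<n)))) (sym eq′))
        where
        max<n : d (u ∷ʳ l) ⊔ d (u ∷ʳ r) < n
        max<n = subst (_≤ n) eq (m<1+n⇒m≤n du<1+n)

    -- Along a branch the rank drops at every state outside `F`, so `F` is reached again from any
    -- position; finiteness of `K` then gives one recurring state.
    Ranks⇒Accepting : ∀ {ρ d} → Ranks ρ d → Accepting 𝒜 ρ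
    Ranks⇒Accepting {ρ} {d} ranks β =
      infinitelyOften-∈ K-finite F (path ρ β) λ n → visit (suc (d (node n))) n ≤-refl
      where
      open Branch β

      visit : ∀ b n → d (node n) < b → ∃[ m ] (m ≥ n × path ρ β m ∈ F)
      visit (suc b) n dn<1+b with ranks (node n)
      ... | inj₁ (ρn∈F , _) = n , ≤-refl , ρn∈F
      ... | inj₂ (_ , eq) =
        let m , m≥1+n , ρm∈F = visit b (suc n) (next (step n))
        in m , ≤-trans (n≤1+n n) m≥1+n , ρm∈F
        where
        max<b : d (node n ∷ʳ l) ⊔ d (node n ∷ʳ r) < b
        max<b = subst (_≤ b) eq (m<1+n⇒m≤n dn<1+b)

        next : node (suc n) ≡ node n ∷ʳ l ⊎ node (suc n) ≡ node n ∷ʳ r → d (node (suc n)) < b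
        next (inj₁ eqₗ) = subst (λ v → d v < b) (sym eqₗ) (≤-<-trans (m≤m⊔n _ _) max<b)
        next (inj₂ eqᵣ) = subst (λ v → d v < b) (sym eqᵣ) (≤-<-trans (m≤n⊔m _ _) max<b)

    -- The closed set of ranked runs and its projection.

    Z : Set
    Z = A × K × ℕ

    label : Z → A
    label = proj₁

    state : Z → K
    state = proj₁ ∘ proj₂

    height : Z → ℕ
    height = proj₂ ∘ proj₂

    Step : Z → Z → Z → Set
    Step z zˡ zʳ =
      (state z , label z , state zˡ , state zʳ) ∈ Δ ×
      RankStep (state z) (height z) (height zˡ) (height zʳ)

    Step-resp : ∀ {y yˡ yʳ z zˡ zʳ} → y ≡ z → yˡ ≡ zˡ → yʳ ≡ zʳ → Step y yˡ yʳ → Step z zˡ zʳ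
    Step-resp refl refl refl step = step

    RankedRun : Pred (Tree Z) 0ℓ
    RankedRun x = state (x []) ≡ q₀ × ∀ u → Step (x u) (x (u ∷ʳ l)) (x (u ∷ʳ r))

    -- A violation is visible at the root alone, or at one node and its two children.
    RankedRun-closed : Closed RankedRun
    RankedRun-closed x x∉ with em {state (x []) ≡ q₀}
    ... | no ≢q₀ = [] ∷ [] , λ { y (eq ∷ []) (init , _) →
      ≢q₀ (trans (cong state (sym eq)) init) }
    ... | yes ≡q₀ with u , ¬step ← ¬∀⇒∃¬ (λ steps → x∉ (≡q₀ , steps)) =
      u ∷ u ∷ʳ l ∷ u ∷ʳ r ∷ [] , λ { y (eq ∷ eqˡ ∷ eqʳ ∷ []) (_ , steps) → ¬step
        (Step-resp eq eqˡ eqʳ (steps u)) }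

    RankedRun-acceptingRun : ∀ {x t} → x ∈ RankedRun → label ∘ x ≗ t → AcceptingRun 𝒜 t (state ∘ x)
    RankedRun-acceptingRun {x} (init , steps) label≗t =
      record
        { initial    = init
        ; transition = λ u → subst (λ a → (state (x u) , a , _ , _) ∈ Δ) (label≗t u)
                               (proj₁ (steps u)) } ,
      Ranks⇒Accepting (proj₂ ∘ steps)

    RankedRun-injective : Unambiguous 𝒜 → ∀ {x y} → x ∈ RankedRun → y ∈ RankedRun →
      label ∘ x ≗ label ∘ y → x ≗ y
    RankedRun-injective unambiguous {x} {y} x∈ y∈ eq u =
      cong₂ _,_ (eq u) (cong₂ _,_ (states u)
        (Ranks-unique states (proj₂ ∘ proj₂ x∈) (proj₂ ∘ proj₂ y∈) u))
      where
      states : state ∘ x ≗ state ∘ y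
      -- Both runs are read on the tree `label ∘ y`; `eq` transports the first one there.
      states = unambiguous _ _ _
        (RankedRun-acceptingRun x∈ eq) (RankedRun-acceptingRun y∈ (λ _ → refl))

    L≐Image : Image label RankedRun ≐ L 𝒜
    L≐Image =
      (λ (x , x∈ , eq) → state ∘ x , RankedRun-acceptingRun x∈ eq) ,
      (λ {t} (ρ , run , accepting) →
        (λ u → t u , ρ u , rank accepting u) ,
        (IsRun.initial run , λ u → IsRun.transition run u , rank-ranks accepting u) ,
        λ _ → refl)

    L-Borel : Unambiguous 𝒜 → Borel (L 𝒜)
    L-Borel unambiguous = resp L≐Image
      (LusinSouslin.image-Borel label
        (×-countable (IsFinite⇒countable A-finite)
          (×-countable (IsFinite⇒countable K-finite) (↣-id ℕ)))
        RankedRun-closed (RankedRun-injective unambiguous))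

corollary4p14 : ExcludedMiddle 0ℓ →
    (A : Set) → IsFinite A →
    (𝒜 : BüchiTreeAutomaton A) → Unambiguous 𝒜 →
    Borel (L 𝒜)
corollary4p14 em A A-finite 𝒜 = Classical.Büchi.L-Borel em A-finite 𝒜
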